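{- Asynchronous parallelising does not satisfy the identity law. That is, there is no computon $\lambda$ such that $\lambda+\lambda_1\cong\lambda_1\cong\lambda_1+\lambda$ for every computon $\lambda_1$ (all computons being in the same computon category).
   Context: Fix $n\ge 1$, the set of types $\underline{n}:=\{0,1,\dots,n-1\}$ (type $0$ is the control type), and a finite nonempty set $B\subset\Sigma^*$ of computing devices over a finite alphabet $\Sigma$, with a distinguished element $\epsilon\in B$. All computons are over these fixed $\underline{n}$ and $B$. **Computon.** A computon $\lambda$ is a tuple $(U,P,I,O,\underline{n},B,\sigma,t,\tau,s,c,r,f)$ where $U$ (computation units), $I$ (inflows), $O$ (outflows) are finite sets, $P$ (ports) is a finite nonempty set, $\sigma\colon O\to U$, $\tau\colon I\to U$ and $r\colon I\to O$ are surjective functions, and $t\colon O\to P$, $s\colon I\to P$, $c\colon P\to\underline{n}$, $f\colon O\to B$ are functions, such that: the restrictions of $\tau$ to $(c\circ s)^{ -1}(0)$ and of $\sigma$ to $(c\circ t)^{ -1}(0)$ are surjective onto $U$; $\sigma\circ r=\tau$; and there exist $p\in P\setminus t(O)$ and $q\in P\setminus s(I)$ with $c(p)=0=c(q)$. Components of a computon $\lambda_k$ carry the index $k$. Write $P^+:=P\setminus t(O)$ (inports), $P^-:=P\setminus s(I)$ (outports), and for $p\in P$ write $p\bullet:=\tau(s^{ -1}(p))$ and $\bullet p:=\sigma(t^{ -1}(p))$. **Morphism.** A computon morphism $\alpha\colon\lambda_1\to\lambda_2$ consists of functions $\alpha_U\colon U_1\to U_2$, $\alpha_P\colon P_1\to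 P_2$, $\alpha_I\colon I_1\to I_2$, $\alpha_O\colon O_1\to O_2$ and the inclusions (identities) on $\underline{n}$ and on $B$, such that $\alpha_U\tau_1=\tau_2\alpha_I$, $\alpha_U\sigma_1=\sigma_2\alpha_O$, $\alpha_P s_1=s_2\alpha_I$, $\alpha_P t_1=t_2\alpha_O$, $\alpha_O r_1=r_2\alpha_I$, $f_2\alpha_O=f_1$, $c_2\alpha_P=c_1$, and $\vec{i}(\alpha)\cup\vec{o}(\alpha)\subseteq P_1^+\cup P_1^-$, where $\vec{i}(\alpha)=\{p\in P_1\mid \bullet\alpha_P(p)\setminus\alpha_U(\bullet p)\ne\emptyset\}$ and $\vec{o}(\alpha)=\{p\in P_1\mid \alpha_P(p)\bullet\setminus\alpha_U(p\bullet)\neq\emptyset\}$. Morphisms compose componentwise; isomorphism $\cong$ means isomorphism in this category. **Asynchronous parallelising.** The async computon $\lambda_1+\lambda_2$ is the coproduct of $\lambda_1$ and $\lambda_2$: its sets of units, ports, inflows and outflows are the disjoint unions $U_1\sqcup U_2$, $P_1\sqcup P_2$, $I_1\sqcup I_2$, $O_1\sqcup O_2$, and each structure function $\sigma,t,\tau,s,c,r,f$ is given by the corresponding function of $\lambda_1$ on elements coming from $\lambda_1$ and of $\lambda_2$ on elements coming from $\lambda_2$. Asynchronous parallelising is the operation $(\lambda_1,\lambda_2)\mapsto\lambda_1+\lambda_2$. -}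

module Defs where

open import Data.Fin.Base using (Fin; toℕ)
open import Data.Fin.Properties using (+↔⊎)
open import Data.List.Base using (List)
open import Data.List.Membership.Propositional using () renaming (_∈_ to _∈ˡ_)
open import Data.Nat.Base as ℕ using (ℕ; _≥_)
open import Data.Product.Base using (∃-syntax; _×_; _,_)
open import Data.Sum.Base as Sum using (_⊎_; inj₁; inj₂; [_,_])
open import Data.Sum.Function.Propositional using (_⊎-↔_)
open import Data.Sum.Properties using (inj₁-injective)
open import Function.Base using (_∘_)
open import Function.Bundles using (_↔_)
open import Function.Definitions using (StrictlySurjective; Inverseᵇ)
open import Function.Construct.Composition using (_↔-∘_)
open import Function.Construct.Symmetry using (↔-sym)
open import Level using (0ℓ)
open import Relation.Binary.PropositionalEquality using (_≡_; _≗_; cong)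
open import Relation.Unary using (Pred; _∈_; _⊆_; _∪_; _∖_; ∁; _⊢_; Satisfiable)

Finite : Set → Set
Finite A = ∃[ k ] (A ↔ Fin k)

finite-⊎ : ∀ {A B} → Finite A → Finite B → Finite (A ⊎ B)
finite-⊎ (k , A↔) (l , B↔) = k ℕ.+ l , (↔-sym +↔⊎ ↔-∘ (A↔ ⊎-↔ B↔))

Image : ∀ {A B : Set} → (A → B) → Pred A 0ℓ → Pred B 0ℓ
Image f Q b = ∃[ a ] (a ∈ Q × f a ≡ b)

Range : ∀ {A B : Set} → (A → B) → Pred B 0ℓ
Range f b = ∃[ a ] f a ≡ b

-- The data over which a category of computons is formed.
record Signature : Set₁ where
  field
    n               : ℕ
    n≥1             : n ≥ 1
    Alphabet        : Set
    alphabet-finite : Finite Alphabet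

  Word : Set
  Word = List Alphabet

  -- The finite set of devices is the set of words occurring in the list B;
  -- order and repetitions play no role.
  field
    B   : List Word
    ε   : Word
    ε∈B : ε ∈ˡ B

  Control : Pred (Fin n) 0ℓ
  Control k = toℕ k ≡ 0

record Computon (S : Signature) : Set₁ where
  open Signature S
  field
    U P I O  : Set
    U-finite : Finite U
    P-finite : Finite P
    I-finite : Finite I
    O-finite : Finite O
    P-nonempty : P

    σ : O → U
    t : O → P
    τ : I → U
    s : I → P
    c : P → Fin n
    r : I → O
    -- A function O → B, as a word-valued function with values in B, so that
    -- devices are compared as words and not as list positions.
    f   : O → Word
    f∈B : ∀ o → f o ∈ˡ B

    σ-surjective : StrictlySurjective _≡_ σ
    τ-surjective : StrictlySurjective _≡_ τ
    r-surjective : StrictlySurjective _≡_ r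

    τ-control-surjective : ∀ u → u ∈ Image τ ((c ∘ s) ⊢ Control)
    σ-control-surjective : ∀ u → u ∈ Image σ ((c ∘ t) ⊢ Control)

    σ∘r≗τ : σ ∘ r ≗ τ

  P⁺ : Pred P 0ℓ
  P⁺ = ∁ (Range t)

  P⁻ : Pred P 0ℓ
  P⁻ = ∁ (Range s)

  field
    control-inport  : ∃[ p ] (p ∈ P⁺ × c p ∈ Control)
    control-outport : ∃[ q ] (q ∈ P⁻ × c q ∈ Control)

  infix 30 _• •_

  _• : P → Pred U 0ℓ
  p • = Image τ (s ⊢ (_≡ p))

  •_ : P → Pred U 0ℓ
  • p = Image σ (t ⊢ (_≡ p))

module _ {S : Signature} where

  -- The components on types and on devices are identities, hence not recorded.
  record Morphism (C₁ C₂ : Computon S) : Set where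
    private
      module C₁ = Computon C₁
      module C₂ = Computon C₂
    field
      αU : C₁.U → C₂.U
      αP : C₁.P → C₂.P
      αI : C₁.I → C₂.I
      αO : C₁.O → C₂.O

      τ-commutes : αU ∘ C₁.τ ≗ C₂.τ ∘ αI
      σ-commutes : αU ∘ C₁.σ ≗ C₂.σ ∘ αO
      s-commutes : αP ∘ C₁.s ≗ C₂.s ∘ αI
      t-commutes : αP ∘ C₁.t ≗ C₂.t ∘ αO
      r-commutes : αO ∘ C₁.r ≗ C₂.r ∘ αI
      f-commutes : C₂.f ∘ αO ≗ C₁.f
      c-commutes : C₂.c ∘ αP ≗ C₁.c

    i⃗ : Pred C₁.P 0ℓ
    i⃗ p = Satisfiable (C₂.• (αP p) ∖ Image αU (C₁.• p))

    o⃗ : Pred C₁.P 0ℓ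
    o⃗ p = Satisfiable (αP p C₂.• ∖ Image αU (p C₁.•))

    field
      boundary : i⃗ ∪ o⃗ ⊆ C₁.P⁺ ∪ C₁.P⁻

  infix 4 _≅_

  -- Morphisms are equal when their components agree pointwise, and they
  -- compose componentwise.
  record _≅_ (C₁ C₂ : Computon S) : Set where
    field
      to   : Morphism C₁ C₂
      from : Morphism C₂ C₁
    private
      module T = Morphism to
      module F = Morphism from
    field
      inverse-U : Inverseᵇ _≡_ _≡_ T.αU F.αU
      inverse-P : Inverseᵇ _≡_ _≡_ T.αP F.αP
      inverse-I : Inverseᵇ _≡_ _≡_ T.αI F.αI
      inverse-O : Inverseᵇ _≡_ _≡_ T.αO F.αO

  infixl 6 _+_

  _+_ : Computon S → Computon S → Computon S
  C₁ + C₂ = record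
    { U = C₁.U ⊎ C₂.U
    ; P = C₁.P ⊎ C₂.P
    ; I = C₁.I ⊎ C₂.I
    ; O = C₁.O ⊎ C₂.O
    ; U-finite = finite-⊎ C₁.U-finite C₂.U-finite
    ; P-finite = finite-⊎ C₁.P-finite C₂.P-finite
    ; I-finite = finite-⊎ C₁.I-finite C₂.I-finite
    ; O-finite = finite-⊎ C₁.O-finite C₂.O-finite
    ; P-nonempty = inj₁ C₁.P-nonempty
    ; σ = Sum.map C₁.σ C₂.σ
    ; t = Sum.map C₁.t C₂.t
    ; τ = Sum.map C₁.τ C₂.τ
    ; s = Sum.map C₁.s C₂.s
    ; c = [ C₁.c , C₂.c ]
    ; r = Sum.map C₁.r C₂.r
    ; f = [ C₁.f , C₂.f ]
    ; f∈B = [ C₁.f∈B , C₂.f∈B ]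
    ; σ-surjective = map-surjective C₁.σ-surjective C₂.σ-surjective
    ; τ-surjective = map-surjective C₁.τ-surjective C₂.τ-surjective
    ; r-surjective = map-surjective C₁.r-surjective C₂.r-surjective
    ; τ-control-surjective = λ where
        (inj₁ u) → let i , ctl , eq = C₁.τ-control-surjective u in inj₁ i , ctl , cong inj₁ eq
        (inj₂ u) → let i , ctl , eq = C₂.τ-control-surjective u in inj₂ i , ctl , cong inj₂ eq
    ; σ-control-surjective = λ where
        (inj₁ u) → let o , ctl , eq = C₁.σ-control-surjective u in inj₁ o , ctl , cong inj₁ eq
        (inj₂ u) → let o , ctl , eq = C₂.σ-control-surjective u in inj₂ o , ctl , cong inj₂ eq
    ; σ∘r≗τ = λ where
        (inj₁ i) → cong inj₁ (C₁.σ∘r≗τ i)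
        (inj₂ i) → cong inj₂ (C₂.σ∘r≗τ i)
    ; control-inport =
        let p , p∈ , ctl = C₁.control-inport in inj₁ p , ∉Range-map p∈ , ctl
    ; control-outport =
        let q , q∈ , ctl = C₁.control-outport in inj₁ q , ∉Range-map q∈ , ctl
    }
    where
    module C₁ = Computon C₁
    module C₂ = Computon C₂

    map-surjective : ∀ {A B C D : Set} {g : A → B} {h : C → D} →
                     StrictlySurjective _≡_ g → StrictlySurjective _≡_ h →
                     StrictlySurjective _≡_ (Sum.map g h)
    map-surjective g-surj h-surj (inj₁ b) = let a , eq = g-surj b in inj₁ a , cong inj₁ eq
    map-surjective g-surj h-surj (inj₂ d) = let c , eq = h-surj d in inj₂ c , cong inj₂ eq

    ∉Range-map : ∀ {A B C D : Set} {g : A → B} {h : C → D} {b : B} →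
                 b ∈ ∁ (Range g) → inj₁ b ∈ ∁ (Range (Sum.map g h))
    ∉Range-map b∉ (inj₁ a , eq) = b∉ (a , inj₁-injective eq)

{-# OPTIONS --safe #-}
-- Isomorphisms are bijective on ports, and ports form a finite nonempty set, so adding
-- λ to any λ₁ strictly increases the number of ports.
module Submission where

open import Defs
open import Data.Fin.Permutation using (↔⇒≡)
open import Data.Nat.Base using (zero; suc)
open import Data.Nat.Properties using (m≢1+n+m)
open import Data.Product using (Σ-syntax; _×_; _,_; proj₁; proj₂)
open import Data.Sum.Base using (_⊎_)
open import Function.Bundles using (_↔_; mk↔; Inverse)
open import Function.Construct.Composition using (_↔-∘_)
open import Function.Construct.Symmetry using (↔-sym)
open import Relation.Binary.PropositionalEquality using (_≡_; sym)
open import Relation.Nullary using (¬_)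

-- The port sets of `C + C₁` and `C₁` would be in bijection, but their sizes differ by that of `C`,
-- which is at least 1; `A⊎B↮B` is this count.

finite-size-unique : ∀ {A B : Set} (A-finite : Finite A) (B-finite : Finite B) →
                     A ↔ B → proj₁ A-finite ≡ proj₁ B-finite
finite-size-unique (_ , A↔) (_ , B↔) A↔B = ↔⇒≡ (B↔ ↔-∘ (A↔B ↔-∘ ↔-sym A↔))

A⊎B↮B : ∀ {A B : Set} → Finite A → Finite B → A → ¬ ((A ⊎ B) ↔ B)
A⊎B↮B (zero , A↔) B-finite a _ with () ← Inverse.to A↔ a
-- With `A` of size 1 + k, the sizes would give 1 + k + l = l.
A⊎B↮B A-finite@(suc _ , _) B-finite@(l , _) _ A⊎B↔B =
  m≢1+n+m l (sym (finite-size-unique (finite-⊎ A-finite B-finite) B-finite A⊎B↔B))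

≅⇒P↔ : ∀ {S : Signature} {C₁ C₂ : Computon S} → C₁ ≅ C₂ → Computon.P C₁ ↔ Computon.P C₂
≅⇒P↔ iso = mk↔ (_≅_.inverse-P iso)

theorem8 : (S : Signature) →
    ¬ (Σ[ C ∈ Computon S ] ((C₁ : Computon S) → (C + C₁ ≅ C₁) × (C₁ ≅ C₁ + C)))
theorem8 S (C , identity) =
  -- The supposed identity is tested against itself, so no further computon has to be built.
  A⊎B↮B P-finite P-finite P-nonempty (≅⇒P↔ (proj₁ (identity C)))
  where open Computon C
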